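{- There exists a signed graph $\Sigma$ whose underlying graph is planar, $2$-connected, has minimum degree $3$, and is obtained from the wheel $W_5 = K_1\vee C_5$ by adding an edge between two non-adjacent vertices, such that $l(\Sigma) = 3$, $p^-(\Sigma) = 2$ and $p_\triangle(\Sigma) = p(\Sigma) = 3$. In particular $p^-(\Sigma) < \min(l(\Sigma), p_\triangle(\Sigma))$, so the equality $p^-(\Sigma)=\min(l(\Sigma),p(\Sigma))$ does not hold for all signed graphs, not even for all planar ones.
   Context: All graphs are finite, simple and undirected. A signed graph $\Sigma=(G,\sigma)$ is a graph $G$ (the underlying graph) with a signature $\sigma:E(G)\to\{+1,-1\}$. The sign of a cycle is the product of the signs of its edges; $\Sigma$ is balanced if all its cycles are positive. The frustration index $l(\Sigma)$ is the minimum number of edges whose deletion makes $\Sigma$ balanced. $p^-(\Sigma)$ is the maximum number of pairwise edge-disjoint negative cycles in $\Sigma$; $p(\Sigma)$ (respectively $p_\triangle(\Sigma)$) is the maximum number of pairwise edge-disjoint cycles (respectively triangles) of any sign in the underlying graph. $C_5$ is the cycle on $5$ vertices and $\vee$ denotes the join. -}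

module Defs where

open import Level using (0ℓ)
open import Data.Fin.Base as Fin using (Fin; toℕ; splitAt)
open import Data.Fin.Properties as Fin using ()
open import Data.Fin.Subset using (Subset; _∉_; ∣_∣)
open import Data.List.Base using (List; []; _∷_; length; filter; allFin)
open import Data.List.Relation.Unary.All using (All)
open import Data.List.Relation.Unary.AllPairs using (AllPairs)
open import Data.List.Relation.Unary.Any as Any using (Any; any?)
open import Data.List.Relation.Unary.Unique.Propositional using (Unique)
open import Data.Nat.Base using (ℕ; suc; _+_; _≤_; _<_; _⊓_; ∣_-_∣)
open import Data.Nat.Properties as ℕ using (∣-∣-comm; ∣n-n∣≡0)
open import Data.Product.Base using (Σ-syntax; ∃-syntax; _×_; _,_; proj₁; proj₂)
open import Data.Rational.Base as ℚ using (ℚ; 0ℚ; 1ℚ)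
open import Data.Sign.Base as Sign using (Sign)
open import Data.Sum.Base as Sum using (_⊎_; inj₁; inj₂)
open import Data.Unit.Base using (⊤; tt)
open import Function.Base using (_∘_)
open import Function.Bundles using (_↔_; _⇔_; Inverse)
open import Function.Definitions using (Injective)
open import Relation.Binary.Core using (Rel)
open import Relation.Binary.Construct.Closure.ReflexiveTransitive using (Star; ε; _◅_)
open import Relation.Binary.Definitions using (Decidable; Symmetric; Irreflexive)
open import Relation.Binary.PropositionalEquality using (_≡_; _≢_; refl; sym; trans; cong)
open import Relation.Nullary.Decidable using (yes; no; ¬?; _×-dec_; _⊎-dec_)
open import Relation.Nullary.Negation using (¬_)

infix 4 _≈ᴱ_

record Graph (n : ℕ) : Set₁ where
  infix 4 _~_ _~?_
  field
    _~_      : Rel (Fin n) 0ℓ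
    _~?_     : Decidable _~_
    ~-sym    : Symmetric _~_
    ~-irrefl : Irreflexive _≡_ _~_

-- An edge is given by its two ends, in either order.
_≈ᴱ_ : ∀ {n} → Rel (Fin n × Fin n) 0ℓ
(u , v) ≈ᴱ (x , y) = (u ≡ x × v ≡ y) ⊎ (u ≡ y × v ≡ x)

_≈ᴱ?_ : ∀ {n} → Decidable (_≈ᴱ_ {n})
(u , v) ≈ᴱ? (x , y) =
  (u Fin.≟ x ×-dec v Fin.≟ y) ⊎-dec (u Fin.≟ y ×-dec v Fin.≟ x)

≈ᴱ-swapˡ : ∀ {n} {u v : Fin n} {e} → (u , v) ≈ᴱ e → (v , u) ≈ᴱ e
≈ᴱ-swapˡ (inj₁ (p , q)) = inj₂ (q , p)
≈ᴱ-swapˡ (inj₂ (p , q)) = inj₁ (q , p)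

_≅_ : ∀ {m n} → Graph m → Graph n → Set
_≅_ {m} {n} G H =
  Σ[ f ∈ Fin m ↔ Fin n ]
    (∀ x y → Graph._~_ G x y ⇔ Graph._~_ H (Inverse.to f x) (Inverse.to f y))

complete : ∀ n → Graph n
complete n = record
  { _~_      = _≢_
  ; _~?_     = λ x y → ¬? (x Fin.≟ y)
  ; ~-sym    = λ x≢y y≡x → x≢y (sym y≡x)
  ; ~-irrefl = λ x≡y x≢y → x≢y x≡y
  }

-- The cycle graph on the 3 + k vertices 0, 1, …, k + 2: two vertices are
-- adjacent when they are consecutive or are the first and last ones.
cycleGraph : ∀ k → Graph (3 + k)
cycleGraph k = record
  { _~_      = λ x y → d x y ≡ 1 ⊎ d x y ≡ 2 + k
  ; _~?_     = λ x y → (d x y ℕ.≟ 1) ⊎-dec (d x y ℕ.≟ 2 + k)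
  ; ~-sym    = λ {x} {y} → Sum.map (trans (d-sym y x)) (trans (d-sym y x))
  ; ~-irrefl = λ { {x} refl (inj₁ p) → 0≢suc (trans (sym (∣n-n∣≡0 (toℕ x))) p)
                 ; {x} refl (inj₂ p) → 0≢suc (trans (sym (∣n-n∣≡0 (toℕ x))) p) }
  }
  where
  d : Fin (3 + k) → Fin (3 + k) → ℕ
  d x y = ∣ toℕ x - toℕ y ∣

  d-sym : ∀ x y → d x y ≡ d y x
  d-sym x y = ∣-∣-comm (toℕ x) (toℕ y)

  0≢suc : ∀ {j} → 0 ≢ suc j
  0≢suc ()

module _ {m n} (G : Graph m) (H : Graph n) where
  private
    module G = Graph G
    module H = Graph H

    V : Set
    V = Fin m ⊎ Fin n

    Adj : Rel V 0ℓ
    Adj (inj₁ x) (inj₁ y) = x G.~ y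
    Adj (inj₁ _) (inj₂ _) = ⊤
    Adj (inj₂ _) (inj₁ _) = ⊤
    Adj (inj₂ x) (inj₂ y) = x H.~ y

    adj? : Decidable Adj
    adj? (inj₁ x) (inj₁ y) = x G.~? y
    adj? (inj₁ _) (inj₂ _) = yes tt
    adj? (inj₂ _) (inj₁ _) = yes tt
    adj? (inj₂ x) (inj₂ y) = x H.~? y

    adj-sym : ∀ a b → Adj a b → Adj b a
    adj-sym (inj₁ _) (inj₁ _) p = G.~-sym p
    adj-sym (inj₁ _) (inj₂ _) p = tt
    adj-sym (inj₂ _) (inj₁ _) p = tt
    adj-sym (inj₂ _) (inj₂ _) p = H.~-sym p

    adj-irrefl : ∀ a → ¬ Adj a a
    adj-irrefl (inj₁ _) = G.~-irrefl refl
    adj-irrefl (inj₂ _) = H.~-irrefl refl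

  infixr 6 _∨_
  _∨_ : Graph (m + n)
  _∨_ = record
    { _~_      = λ x y → Adj (splitAt m x) (splitAt m y)
    ; _~?_     = λ x y → adj? (splitAt m x) (splitAt m y)
    ; ~-sym    = λ {x} {y} → adj-sym (splitAt m x) (splitAt m y)
    ; ~-irrefl = λ { {x} refl → adj-irrefl (splitAt m x) }
    }

K₁ : Graph 1
K₁ = complete 1

C₅ : Graph 5
C₅ = cycleGraph 2

W₅ : Graph 6
W₅ = K₁ ∨ C₅

addEdge : ∀ {n} (G : Graph n) (u v : Fin n) → u ≢ v → Graph n
addEdge G u v u≢v = record
  { _~_      = λ x y → x ~ y ⊎ (x , y) ≈ᴱ (u , v)
  ; _~?_     = λ x y → (x ~? y) ⊎-dec ((x , y) ≈ᴱ? (u , v))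
  ; ~-sym    = Sum.map ~-sym ≈ᴱ-swapˡ
  ; ~-irrefl = λ { refl (inj₁ p) → ~-irrefl refl p
                 ; refl (inj₂ (inj₁ (p , q))) → u≢v (trans (sym p) q)
                 ; refl (inj₂ (inj₂ (p , q))) → u≢v (trans (sym q) p) }
  }
  where open Graph G

deleteEdges : ∀ {n} → Graph n → List (Fin n × Fin n) → Graph n
deleteEdges G F = record
  { _~_      = λ x y → x ~ y × ¬ Any ((x , y) ≈ᴱ_) F
  ; _~?_     = λ x y → (x ~? y) ×-dec ¬? (any? ((x , y) ≈ᴱ?_) F)
  ; ~-sym    = λ { (p , ∉F) → ~-sym p , ∉F ∘ Any.map ≈ᴱ-swapˡ }
  ; ~-irrefl = λ x≡y p → ~-irrefl x≡y (proj₁ p)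
  }
  where
  open Graph G

-- H is G plus an edge between two non-adjacent vertices, up to isomorphism.
IsEdgeAddition : ∀ {m n} → Graph m → Graph n → Set
IsEdgeAddition H G =
  ∃[ u ] ∃[ v ] Σ[ u≢v ∈ u ≢ v ]
    (¬ Graph._~_ G u v × (H ≅ addEdge G u v u≢v))

degree : ∀ {n} → Graph n → Fin n → ℕ
degree {n} G v = length (filter (v ~?_) (allFin n))
  where open Graph G

MinDegree : ∀ {n} → Graph n → ℕ → Set
MinDegree G d = (∀ v → d ≤ degree G v) × (∃[ v ] degree G v ≡ d)

VertexConnected : ℕ → ∀ {n} → Graph n → Set
VertexConnected k {n} G =
  k < n ×
  (∀ (X : Subset n) → ∣ X ∣ < k → ∀ {u v} → u ∉ X → v ∉ X →
     Star (λ x y → x ~ y × x ∉ X × y ∉ X) u v)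
  where open Graph G

-- Plane graphs are drawn with polygonal arcs.  ℚ² can replace ℝ²: every planar
-- graph has such a drawing with rational corners, and the intersection in ℝ² of
-- two segments with rational ends is empty, a rational point, or a segment with
-- rational ends.
Point : Set
Point = ℚ × ℚ

_∈[_,_] : Point → Point → Point → Set
(z₁ , z₂) ∈[ (a₁ , a₂) , (b₁ , b₂) ] =
  ∃[ t ] (0ℚ ℚ.≤ t × t ℚ.≤ 1ℚ ×
          z₁ ≡ a₁ ℚ.+ t ℚ.* (b₁ ℚ.- a₁) ×
          z₂ ≡ a₂ ℚ.+ t ℚ.* (b₂ ℚ.- a₂))

-- Non-self-intersecting polygonal arcs, mutually with their sets of points.
data Arc : Point → Point → Set
_∈ᴬ_ : ∀ {a b} → Point → Arc a b → Set

data Arc where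
  segment : ∀ {a b} → a ≢ b → Arc a b
  extend  : ∀ {a c b} → a ≢ c → (γ : Arc c b) →
            (∀ z → z ∈[ a , c ] → z ∈ᴬ γ → z ≡ c) → Arc a b

_∈ᴬ_ {a} {b} z (segment _)              = z ∈[ a , b ]
_∈ᴬ_ {a}     z (extend {c = c} _ γ _)   = z ∈[ a , c ] ⊎ z ∈ᴬ γ

record PlaneDrawing {n} (G : Graph n) : Set where
  open Graph G
  field
    pos           : Fin n → Point
    pos-injective : Injective _≡_ _≡_ pos
    arc           : ∀ {u v} → u ~ v → Arc (pos u) (pos v)
    -- The point set of an edge does not depend on the order of its ends
    -- (nor on the proof of adjacency).
    arc-sym       : ∀ {u v} (p : u ~ v) (q : v ~ u) {z} →
                    z ∈ᴬ arc p → z ∈ᴬ arc q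
    -- The interior of an edge contains no vertex and no point of another edge.
    arc-vertex    : ∀ {u v} (p : u ~ v) w → pos w ∈ᴬ arc p → w ≡ u ⊎ w ≡ v
    arc-arc       : ∀ {u v x y} (p : u ~ v) (q : x ~ y) →
                    ¬ (u , v) ≈ᴱ (x , y) →
                    ∀ {z} → z ∈ᴬ arc p → z ∈ᴬ arc q → z ≡ pos u ⊎ z ≡ pos v

Planar : ∀ {n} → Graph n → Set
Planar = PlaneDrawing

module _ {n} (G : Graph n) where
  open Graph G

  starts : ∀ {u v} → Star _~_ u v → List (Fin n)
  starts ε               = []
  starts (_◅_ {u} _ w)   = u ∷ starts w

  walkEdges : ∀ {u v} → Star _~_ u v → List (Fin n × Fin n)
  walkEdges ε                 = []
  walkEdges (_◅_ {u} {v} _ w) = (u , v) ∷ walkEdges w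

  -- A cycle, traversed from a chosen vertex in a chosen direction.  Different
  -- traversals of one cycle have the same edges, so this choice does not
  -- affect the packing numbers below.
  record Cycle : Set where
    field
      {base}   : Fin n
      walk     : Star _~_ base base
      distinct : Unique (starts walk)
      long     : 3 ≤ length (starts walk)

module _ {n} {G : Graph n} where

  cycleEdges : Cycle G → List (Fin n × Fin n)
  cycleEdges c = walkEdges G (Cycle.walk c)

  IsTriangle : Cycle G → Set
  IsTriangle c = length (cycleEdges c) ≡ 3

  EdgeDisjoint : Rel (Cycle G) 0ℓ
  EdgeDisjoint c d = All (λ e → All (λ f → ¬ e ≈ᴱ f) (cycleEdges d)) (cycleEdges c)

record SignedGraph (n : ℕ) : Set₁ where
  field
    graph : Graph n
  open Graph graph public
  field
    sign     : ∀ {u v} → u ~ v → Sign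
    sign-sym : ∀ {u v} (p : u ~ v) (q : v ~ u) → sign p ≡ sign q

open SignedGraph public using (graph)

module _ {n} (S : SignedGraph n) where
  open SignedGraph S hiding (graph)

  walkSign : ∀ {u v} → Star _~_ u v → Sign
  walkSign ε       = Sign.+
  walkSign (e ◅ w) = sign e Sign.* walkSign w

  cycleSign : Cycle (graph S) → Sign
  cycleSign c = walkSign (Cycle.walk c)

  Balanced : Set
  Balanced = ∀ c → cycleSign c ≡ Sign.+

  IsNegative : Cycle (graph S) → Set
  IsNegative c = cycleSign c ≡ Sign.-

infixl 6 _∖_
_∖_ : ∀ {n} → SignedGraph n → List (Fin n × Fin n) → SignedGraph n
S ∖ F = record
  { graph    = deleteEdges (graph S) F
  ; sign     = sign ∘ proj₁
  ; sign-sym = λ p q → sign-sym (proj₁ p) (proj₁ q)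
  }
  where open SignedGraph S hiding (graph)

-- Invariants are relations: FrustrationIndex S k says that l(S) = k, and so on.
IsMaximum IsMinimum : (ℕ → Set) → ℕ → Set
IsMaximum P k = P k × (∀ {j} → P j → j ≤ k)
IsMinimum P k = P k × (∀ {j} → P j → k ≤ j)

module _ {n} (S : SignedGraph n) where
  open SignedGraph S hiding (graph)

  -- F is a set of edges, listed without repetition, whose deletion makes S
  -- balanced.
  IsBalancingSet : List (Fin n × Fin n) → Set
  IsBalancingSet F =
    All (λ (u , v) → u ~ v) F × AllPairs (λ e f → ¬ e ≈ᴱ f) F × Balanced (S ∖ F)

  FrustrationIndex : ℕ → Set
  FrustrationIndex = IsMinimum λ k → ∃[ F ] (IsBalancingSet F × length F ≡ k)

HasPacking : ∀ {n} (G : Graph n) → (Cycle G → Set) → ℕ → Set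
HasPacking G P k =
  Σ[ cs ∈ List (Cycle G) ] (All P cs × AllPairs EdgeDisjoint cs × length cs ≡ k)

CyclePackingNumber TrianglePackingNumber : ∀ {n} → Graph n → ℕ → Set
CyclePackingNumber    G = IsMaximum (HasPacking G λ _ → ⊤)
TrianglePackingNumber G = IsMaximum (HasPacking G IsTriangle)

NegativeCyclePackingNumber : ∀ {n} → SignedGraph n → ℕ → Set
NegativeCyclePackingNumber S = IsMaximum (HasPacking (graph S) (IsNegative S))

-- p⁻(S) = min(l(S), p(S))
PackingEquality : ∀ {n} → SignedGraph n → Set
PackingEquality S =
  ∀ {p⁻ l p} → NegativeCyclePackingNumber S p⁻ → FrustrationIndex S l →
  CyclePackingNumber (graph S) p → p⁻ ≡ l ⊓ p

{-# OPTIONS --safe #-}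

-- Number the hub 0 and the rim 1, …, 5, add the chord 13, and make 02, 13 and 45
-- the negative edges.  All four triangles on {0,1,2,3} are negative and any edge
-- lies in at most two of them, so balancing needs two edges there, and a third
-- one for the edge-disjoint negative triangle 045.
--
-- At a vertex v at most ⌊deg v / 2⌋ edge-disjoint cycles meet, so a cycle packing
-- has at most 2 + 2 + 1 + 2 + 1 + 1 = 9 edges.  Hence there are at most three
-- cycles, and if there are three then all are triangles.  But among three negative
-- triangles some two share an edge.
module Submission where

open import Defs
open import Data.Nat.Base using (ℕ; zero; suc; _+_; _*_; _≤_; _<_; _⊓_; z≤n; s≤s; ⌊_/2⌋)
open import Data.Product.Base using (Σ-syntax; ∃-syntax; _×_; _,_; proj₁; proj₂)
open import Relation.Nullary.Negation using (¬_; contradiction)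

import Algebra.Properties.CommutativeMonoid.Sum
open import Data.Bool.Base using (true; false; if_then_else_)
open import Data.Fin.Base as Fin using (Fin; zero; suc)
open import Data.Fin.Patterns using (0F; 1F; 2F; 3F; 4F; 5F)
open import Data.Fin.Properties as Fin using (injective⇒≤)
open import Data.Fin.Subset as Subset using (Subset; ∣_∣)
open import Data.Fin.Subset.Properties using (_∈?_; x∈p∧x≢y⇒x∈p-y; x∈p⇒∣p-x∣<∣p∣)
open import Data.Integer.Base using (+_)
open import Data.List.Base
  using (List; []; _∷_; [_]; _++_; length; map; filter; concatMap; lookup; allFin)
open import Data.List.Membership.Propositional using (_∈_)
open import Data.List.Membership.Propositional.Properties
  using (∈-lookup; ∈-map⁺; ∈-filter⁺; ∈-filter⁻; ∈-allFin)
open import Data.List.Membership.Setoid.Properties using (index-injective)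
open import Data.List.Properties using (length-++; length-map; filter-++; map-++)
open import Data.List.Relation.Binary.Permutation.Propositional
  using (_↭_; prep; swap; ↭-refl; ↭-sym; ↭-trans)
open import Data.List.Relation.Binary.Permutation.Propositional.Properties
  using (filter-↭; ↭-length; shift; drop-∷; ++⁺)
open import Data.List.Relation.Unary.All as All using (All; []; _∷_; all?)
open import Data.List.Relation.Unary.All.Properties as All using (¬Any⇒All¬)
open import Data.List.Relation.Unary.AllPairs as AllPairs using (AllPairs; []; _∷_; allPairs?)
open import Data.List.Relation.Unary.AllPairs.Properties as AllPairs using ()
open import Data.List.Relation.Unary.Any as Any using (Any; here; any?)
open import Data.List.Relation.Unary.Unique.Propositional using (Unique)
open import Data.Nat.Properties as ℕ using (+-0-commutativeMonoid)
import Data.Product.Base as Product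
open import Data.Product.Properties using (≡-dec)
open import Data.Rational.Base as ℚ using (ℚ; 0ℚ; 1ℚ; _/_)
open import Data.Rational.Properties as ℚ using ()
open import Data.Rational.Solver using (module +-*-Solver)
open import Data.Sign.Base as Sign using (Sign)
open import Data.Sign.Properties as Sign using ()
open import Data.Sum.Base as Sum using (_⊎_; inj₁; inj₂; [_,_]′)
open import Data.Unit.Base using (tt)
open import Function.Base using (_∘_; id)
open import Function.Bundles using (mk⇔)
open import Function.Construct.Identity using (↔-id)
open import Function.Definitions using (Injective)
open import Relation.Binary.Construct.Closure.ReflexiveTransitive using (Star; ε; _◅_)
open import Relation.Binary.PropositionalEquality
  using (_≡_; _≢_; _≗_; refl; sym; trans; cong; cong₂; subst; setoid; module ≡-Reasoning)
open import Relation.Nullary.Decidable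
  using (Dec; yes; no; does; True; toWitness; from-yes; dec-false; does-⇔; decidable-stable;
         ¬?; _×-dec_; _⊎-dec_; _→-dec_)
open import Relation.Unary using (Decidable)

open +-*-Solver using (solve; _:=_; _:+_; _:-_; _:*_; con)
-- Counting list entries

open Algebra.Properties.CommutativeMonoid.Sum +-0-commutativeMonoid
  using (sum; ∑-distrib-+; sum-cong-≗; sum-replicate-zero)

module _ {A : Set} where

  lookup-injective : ∀ {xs : List A} → Unique xs → ∀ {i j} → lookup xs i ≡ lookup xs j → i ≡ j
  lookup-injective (_ ∷ _)     {zero}  {zero}  _  = refl
  lookup-injective (x∉xs ∷ _)  {zero}  {suc j} eq = contradiction eq (All.lookup x∉xs (∈-lookup j))
  lookup-injective (x∉xs ∷ _)  {suc i} {zero}  eq = contradiction (sym eq) (All.lookup x∉xs (∈-lookup i))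
  lookup-injective (_ ∷ xs!)   {suc i} {suc j} eq = cong suc (lookup-injective xs! eq)

  -- Send each position in `xs` to a position of the same entry in `ys`. Equal positions hold equal
  -- entries and `xs` repeats none, so this map is injective.
  Unique⇒length-mono-⊆ : ∀ {xs ys : List A} → Unique xs → (∀ {z} → z ∈ xs → z ∈ ys) →
                         length xs ≤ length ys
  Unique⇒length-mono-⊆ {xs} xs! xs⊆ys =
    injective⇒≤ {f = λ i → Any.index (xs⊆ys (∈-lookup {xs = xs} i))} λ eq →
      lookup-injective xs! (index-injective (setoid A) (xs⊆ys (∈-lookup _)) (xs⊆ys (∈-lookup _)) eq)

  length-filter-map : ∀ {B : Set} {P : B → Set} (P? : Decidable P) (f : A → B) xs →
                      length (filter P? (map f xs)) ≡ length (filter (P? ∘ f) xs)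
  length-filter-map P? f []       = refl
  length-filter-map P? f (x ∷ xs) with does (P? (f x))
  ... | true  = cong suc (length-filter-map P? f xs)
  ... | false = length-filter-map P? f xs

module _ {n : ℕ} where

  count : Fin n → List (Fin n) → ℕ
  count v = length ∘ filter (v Fin.≟_)

  count-++ : ∀ v xs ys → count v (xs ++ ys) ≡ count v xs + count v ys
  count-++ v xs ys = trans (cong length (filter-++ (v Fin.≟_) xs ys)) (length-++ (filter (v Fin.≟_) xs))

  count-↭ : ∀ v {xs ys} → xs ↭ ys → count v xs ≡ count v ys
  count-↭ v = ↭-length ∘ filter-↭ (v Fin.≟_)

∑-count-[_] : ∀ {n} (x : Fin n) → sum (λ v → count v [ x ]) ≡ 1
∑-count-[_] {suc n} zero    = cong suc (sum-replicate-zero n)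
∑-count-[_] {suc n} (suc x) = trans (sum-cong-≗ count-suc) ∑-count-[ x ]
  where
  count-suc : (λ v → count (suc v) [ suc x ]) ≗ (λ v → count v [ x ])
  count-suc v with does (v Fin.≟ x)
  ... | true  = refl
  ... | false = refl

length≡∑-count : ∀ {n} (xs : List (Fin n)) → length xs ≡ sum (λ v → count v xs)
length≡∑-count {n} []       = sym (sum-replicate-zero n)
length≡∑-count     (x ∷ xs) = begin
  1 + length xs                                           ≡⟨ cong₂ _+_ (sym ∑-count-[ x ]) (length≡∑-count xs) ⟩
  sum (λ v → count v [ x ]) + sum (λ v → count v xs)      ≡⟨ ∑-distrib-+ (λ v → count v [ x ]) (λ v → count v xs) ⟨
  sum (λ v → count v [ x ] + count v xs)                  ≡⟨ sum-cong-≗ (λ v → count-++ v [ x ] xs) ⟨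
  sum (λ v → count v (x ∷ xs))                            ∎
  where open ≡-Reasoning

sum-mono-≤ : ∀ {n} {f g : Fin n → ℕ} → (∀ i → f i ≤ g i) → sum f ≤ sum g
sum-mono-≤ {zero}  f≤g = z≤n
sum-mono-≤ {suc n} f≤g = ℕ.+-mono-≤ (f≤g zero) (sum-mono-≤ (f≤g ∘ suc))

module _ {n : ℕ} where

  ≈ᴱ-sym : ∀ {e f : Fin n × Fin n} → e ≈ᴱ f → f ≈ᴱ e
  ≈ᴱ-sym (inj₁ (refl , refl)) = inj₁ (refl , refl)
  ≈ᴱ-sym (inj₂ (refl , refl)) = inj₂ (refl , refl)

  ≈ᴱ-trans : ∀ {e f g : Fin n × Fin n} → e ≈ᴱ f → f ≈ᴱ g → e ≈ᴱ g
  ≈ᴱ-trans (inj₁ (refl , refl)) f≈g = f≈g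
  ≈ᴱ-trans (inj₂ (refl , refl)) f≈g = ≈ᴱ-swapˡ f≈g

  -- Both orientations of an edge. An end at `v` becomes a dart starting at `v`, so the edges at `v`
  -- can be counted through first components alone.
  darts : Fin n × Fin n → List (Fin n × Fin n)
  darts e = e ∷ Product.swap e ∷ []

  map-proj₁-darts : ∀ es → map proj₁ (concatMap darts es) ↭ map proj₁ es ++ map proj₂ es
  map-proj₁-darts []             = ↭-refl
  map-proj₁-darts ((u , v) ∷ es) =
    prep u (↭-trans (prep v (map-proj₁-darts es)) (↭-sym (shift v (map proj₁ es) (map proj₂ es))))

-- Edge-disjoint cycles

module _ {n} (G : Graph n) where
  open Graph G

  Adjacent : Fin n × Fin n → Set
  Adjacent (u , v) = u ~ v

  darts-unique : ∀ {es} → All Adjacent es → AllPairs (λ e f → ¬ e ≈ᴱ f) es →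
                 Unique (concatMap darts es)
  darts-unique es~ es! =
    AllPairs.concat⁺
      (All.map⁺ (All.map (λ u~v → ((λ { refl → ~-irrefl refl u~v }) ∷ []) ∷ [] ∷ []) es~))
      (AllPairs.map⁺ (AllPairs.map distinct es!))
    where
    distinct : ∀ {e f} → ¬ e ≈ᴱ f → All (λ d → All (d ≢_) (darts f)) (darts e)
    distinct e≉f =
      ((λ { refl → e≉f (inj₁ (refl , refl)) }) ∷ (λ { refl → e≉f (inj₂ (refl , refl)) }) ∷ []) ∷
      ((λ { refl → e≉f (inj₂ (refl , refl)) }) ∷ (λ { refl → e≉f (inj₁ (refl , refl)) }) ∷ []) ∷ []

  darts-adjacent : ∀ {es} → All Adjacent es → All Adjacent (concatMap darts es)
  darts-adjacent []          = []
  darts-adjacent (u~v ∷ es~) = u~v ∷ ~-sym u~v ∷ darts-adjacent es~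

  -- The ends at `v` correspond to the darts leaving `v`. By `darts-unique` these do not repeat, and
  -- each is `v` paired with one of its neighbours.
  count-ends≤degree : ∀ {es} → All Adjacent es → AllPairs (λ e f → ¬ e ≈ᴱ f) es →
                      ∀ v → count v (map proj₁ es ++ map proj₂ es) ≤ degree G v
  count-ends≤degree {es} es~ es! v = begin
    count v (map proj₁ es ++ map proj₂ es)        ≡⟨ count-↭ v (map-proj₁-darts es) ⟨
    count v (map proj₁ (concatMap darts es))      ≡⟨ length-filter-map (v Fin.≟_) proj₁ (concatMap darts es) ⟩
    length (filter from? (concatMap darts es))    ≤⟨ Unique⇒length-mono-⊆ out! out⊆ ⟩
    length (map (v ,_) (filter (v ~?_) (allFin n))) ≡⟨ length-map (v ,_) (filter (v ~?_) (allFin n)) ⟩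
    degree G v                                    ∎
    where
    open ℕ.≤-Reasoning
    from? : Decidable (λ (e : Fin n × Fin n) → v ≡ proj₁ e)
    from? e = v Fin.≟ proj₁ e

    out! : Unique (filter from? (concatMap darts es))
    out! = AllPairs.filter⁺ from? (darts-unique es~ es!)

    out⊆ : ∀ {e} → e ∈ filter from? (concatMap darts es) →
           e ∈ map (v ,_) (filter (v ~?_) (allFin n))
    out⊆ e∈ with ∈-filter⁻ from? {xs = concatMap darts es} e∈
    ... | e∈darts , refl =
      ∈-map⁺ (v ,_) (∈-filter⁺ (v ~?_) (∈-allFin _) (All.lookup (darts-adjacent es~) e∈darts))

  walkEdges-adjacent : ∀ {u v} (w : Star _~_ u v) → All Adjacent (walkEdges G w)
  walkEdges-adjacent ε       = []
  walkEdges-adjacent (e ◅ w) = e ∷ walkEdges-adjacent w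

  length-walkEdges : ∀ {u v} (w : Star _~_ u v) → length (walkEdges G w) ≡ length (starts G w)
  length-walkEdges ε       = refl
  length-walkEdges (_ ◅ w) = cong suc (length-walkEdges w)

  -- Inside a walk the target of each edge is the source of the next, so only the two ends of the
  -- walk stay unmatched. For a closed walk they coincide and cancel.
  walkEdges-ends : ∀ {u v} (w : Star _~_ u v) →
                   v ∷ map proj₁ (walkEdges G w) ↭ u ∷ map proj₂ (walkEdges G w)
  walkEdges-ends ε       = ↭-refl
  walkEdges-ends (e ◅ w) = ↭-trans (swap _ _ ↭-refl) (prep _ (walkEdges-ends w))

  All-sources : ∀ {P : Fin n → Set} {u v} (w : Star _~_ u v) → All P (starts G w) →
                All (P ∘ proj₁) (walkEdges G w)
  All-sources ε       []         = []
  All-sources (_ ◅ w) (pu ∷ ps)  = pu ∷ All-sources w ps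

  All-targets : ∀ {P : Fin n → Set} {u v} (w : Star _~_ u v) → All P (starts G w) → P v →
                All (P ∘ proj₂) (walkEdges G w)
  All-targets ε             []              _  = []
  All-targets (_ ◅ ε)       _               pv = pv ∷ []
  All-targets (_ ◅ e ◅ w) (_ ∷ ps@(px ∷ _)) pv = px ∷ All-targets (e ◅ w) ps pv

  -- The walk is a path, since `v` is not among its starts either. Hence the source of an edge is
  -- neither source nor target of any later edge.
  path-edges-distinct : ∀ {u v} (w : Star _~_ u v) → Unique (starts G w) → All (v ≢_) (starts G w) →
                        AllPairs (λ e f → ¬ e ≈ᴱ f) (walkEdges G w)
  path-edges-distinct ε       _          _           = []
  path-edges-distinct (e ◅ w) (u∉w ∷ w!) (v≢u ∷ v∉w) =
    All.zipWith (λ { (u≢x , _) (inj₁ (u≡x , _)) → u≢x u≡x ; (_ , u≢y) (inj₂ (u≡y , _)) → u≢y u≡y })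
      (All-sources w u∉w , All-targets w u∉w (v≢u ∘ sym))
    ∷ path-edges-distinct w w! v∉w

  -- A closed walk is not a path, but dropping its first edge leaves one. The dropped edge is
  -- compared separately with the rest: length at least three yields a vertex `v′` after `v` with
  -- `u ≢ v′`, so the second edge is not the first one reversed.
  cycle-edges-distinct : (c : Cycle G) → AllPairs (λ e f → ¬ e ≈ᴱ f) (cycleEdges c)
  cycle-edges-distinct record { walk = ε ; long = () }
  cycle-edges-distinct record { walk = _ ◅ ε ; long = s≤s () }
  cycle-edges-distinct record { walk = _ ◅ _ ◅ ε ; long = s≤s (s≤s ()) }
  cycle-edges-distinct record { walk     = _ ◅ w@(_ ◅ w′@(_ ◅ _))
                              ; distinct = u∉w@(u≢v ∷ u≢v′ ∷ _) ∷ w!@(v∉w′ ∷ _) } =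
    ((λ { (inj₁ (u≡v , _)) → u≢v u≡v ; (inj₂ (u≡v′ , _)) → u≢v′ u≡v′ }) ∷
     All.zipWith (λ { (u≢x , _) (inj₁ (u≡x , _)) → u≢x u≡x ; (_ , v≢x) (inj₂ (_ , v≡x)) → v≢x v≡x })
       (All.tail (All-sources w u∉w) , All-sources w′ v∉w′))
    ∷ path-edges-distinct w w! u∉w

  packing-ends : ∀ (cs : List (Cycle G)) →
                 map proj₁ (concatMap cycleEdges cs) ↭ map proj₂ (concatMap cycleEdges cs)
  packing-ends []       = ↭-refl
  packing-ends (c ∷ cs)
    rewrite map-++ proj₁ (cycleEdges c) (concatMap cycleEdges cs)
          | map-++ proj₂ (cycleEdges c) (concatMap cycleEdges cs)
    = ++⁺ (drop-∷ (walkEdges-ends (Cycle.walk c))) (packing-ends cs)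

  -- At every vertex, edge-disjoint cycles use twice as many edges as there are
  -- cycles through that vertex.
  packing-length≤ : ∀ {cs : List (Cycle G)} → AllPairs EdgeDisjoint cs →
                    length (concatMap cycleEdges cs) ≤ sum (λ v → ⌊ degree G v /2⌋)
  packing-length≤ {cs} cs! = begin
    length es                             ≡⟨ length-map proj₁ es ⟨
    length (map proj₁ es)                 ≡⟨ length≡∑-count (map proj₁ es) ⟩
    sum (λ v → count v (map proj₁ es))    ≤⟨ sum-mono-≤ visits≤ ⟩
    sum (λ v → ⌊ degree G v /2⌋)          ∎
    where
    open ℕ.≤-Reasoning
    es = concatMap cycleEdges cs

    es~ : All Adjacent es
    es~ = All.concat⁺ (All.map⁺ (All.universal (walkEdges-adjacent ∘ Cycle.walk) cs))

    es! : AllPairs (λ e f → ¬ e ≈ᴱ f) es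
    es! = AllPairs.concat⁺ (All.map⁺ (All.universal cycle-edges-distinct cs)) (AllPairs.map⁺ cs!)

    visits≤ : ∀ v → count v (map proj₁ es) ≤ ⌊ degree G v /2⌋
    visits≤ v = begin
      k                                             ≡⟨ ℕ.n≡⌊n+n/2⌋ k ⟩
      ⌊ k + k /2⌋                                   ≡⟨ cong (λ l → ⌊ k + l /2⌋) (count-↭ v (packing-ends cs)) ⟩
      ⌊ k + count v (map proj₂ es) /2⌋              ≡⟨ cong ⌊_/2⌋ (count-++ v (map proj₁ es) (map proj₂ es)) ⟨
      ⌊ count v (map proj₁ es ++ map proj₂ es) /2⌋  ≤⟨ ℕ.⌊n/2⌋-mono (count-ends≤degree es~ es! v) ⟩
      ⌊ degree G v /2⌋                              ∎
      where k = count v (map proj₁ es)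

  cycle-length≥3 : (c : Cycle G) → 3 ≤ length (cycleEdges c)
  cycle-length≥3 c = subst (3 ≤_) (sym (length-walkEdges (Cycle.walk c))) (Cycle.long c)

  3*length≤packing-length : ∀ (cs : List (Cycle G)) → length cs * 3 ≤ length (concatMap cycleEdges cs)
  3*length≤packing-length []       = z≤n
  3*length≤packing-length (c ∷ cs) = begin
    3 + length cs * 3
      ≤⟨ ℕ.+-mono-≤ (cycle-length≥3 c) (3*length≤packing-length cs) ⟩
    length (cycleEdges c) + length (concatMap cycleEdges cs)
      ≡⟨ length-++ (cycleEdges c) ⟨
    length (concatMap cycleEdges (c ∷ cs)) ∎
    where open ℕ.≤-Reasoning

-- Straight-line drawings

p≤q⇒0≤q-p : ∀ {p q} → p ℚ.≤ q → 0ℚ ℚ.≤ q ℚ.- p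
p≤q⇒0≤q-p {p} {q} p≤q = subst (ℚ._≤ q ℚ.- p) (ℚ.+-inverseʳ p) (ℚ.+-monoˡ-≤ (ℚ.- p) p≤q)

-- Twice the signed area of the triangle on the three points in this order. Its sign tells on which
-- side of the line through the first two points the third one lies.
side : Point → Point → Point → ℚ
side (a₁ , a₂) (b₁ , b₂) (z₁ , z₂) =
  (b₁ ℚ.- a₁) ℚ.* (z₂ ℚ.- a₂) ℚ.- (b₂ ℚ.- a₂) ℚ.* (z₁ ℚ.- a₁)

along : Point → Point → ℚ → Point
along (a₁ , a₂) (b₁ , b₂) t = a₁ ℚ.+ t ℚ.* (b₁ ℚ.- a₁) , a₂ ℚ.+ t ℚ.* (b₂ ℚ.- a₂)

-- `side r s` is an affine function of its last argument. Moving the origin to `r` and then treating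
-- coordinate differences as variables splits the claim into two polynomial identities.
side-along : ∀ r s a b t →
  side r s (along a b t) ≡ (1ℚ ℚ.- t) ℚ.* side r s a ℚ.+ t ℚ.* side r s b
side-along (r₁ , r₂) (s₁ , s₂) (a₁ , a₂) (b₁ , b₂) t = trans
  (cong₂ (λ x y → (s₁ ℚ.- r₁) ℚ.* y ℚ.- (s₂ ℚ.- r₂) ℚ.* x) (translate a₁ b₁ r₁) (translate a₂ b₂ r₂))
  (bilinear (s₁ ℚ.- r₁) (s₂ ℚ.- r₂) (1ℚ ℚ.- t) t (a₁ ℚ.- r₁) (a₂ ℚ.- r₂) (b₁ ℚ.- r₁) (b₂ ℚ.- r₂))
  where
  translate : ∀ a b r → a ℚ.+ t ℚ.* (b ℚ.- a) ℚ.- r ≡ (1ℚ ℚ.- t) ℚ.* (a ℚ.- r) ℚ.+ t ℚ.* (b ℚ.- r)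
  translate = solve 4 (λ t a b r →
    a :+ t :* (b :- a) :- r := (con 1ℚ :- t) :* (a :- r) :+ t :* (b :- r)) refl t

  bilinear : ∀ p q c t x₁ x₂ y₁ y₂ →
    p ℚ.* (c ℚ.* x₂ ℚ.+ t ℚ.* y₂) ℚ.- q ℚ.* (c ℚ.* x₁ ℚ.+ t ℚ.* y₁)
    ≡ c ℚ.* (p ℚ.* x₂ ℚ.- q ℚ.* x₁) ℚ.+ t ℚ.* (p ℚ.* y₂ ℚ.- q ℚ.* y₁)
  bilinear = solve 8 (λ p q c t x₁ x₂ y₁ y₂ →
    p :* (c :* x₂ :+ t :* y₂) :- q :* (c :* x₁ :+ t :* y₁)
    := c :* (p :* x₂ :- q :* x₁) :+ t :* (p :* y₂ :- q :* y₁)) refl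

along-0 : ∀ a b → along a b 0ℚ ≡ a
along-0 (a₁ , a₂) (b₁ , b₂) = cong₂ _,_ (eq a₁ b₁) (eq a₂ b₂)
  where
  eq : ∀ x y → x ℚ.+ 0ℚ ℚ.* (y ℚ.- x) ≡ x
  eq x y = solve 2 (λ x y → x :+ con 0ℚ :* (y :- x) := x) refl x y

∈-startpoint : ∀ a b → a ∈[ a , b ]
∈-startpoint a b =
  0ℚ , ℚ.≤-refl , from-yes (0ℚ ℚ.≤? 1ℚ) , cong proj₁ (sym (along-0 a b)) , cong proj₂ (sym (along-0 a b))

∈-reverse : ∀ {a b z} → z ∈[ a , b ] → z ∈[ b , a ]
∈-reverse {a₁ , a₂} {b₁ , b₂} (t , 0≤t , t≤1 , z₁≡ , z₂≡) =
  1ℚ ℚ.- t , p≤q⇒0≤q-p t≤1 , 1-t≤1 , trans z₁≡ (eq a₁ b₁) , trans z₂≡ (eq a₂ b₂)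
  where
  1-t≤1 : 1ℚ ℚ.- t ℚ.≤ 1ℚ
  1-t≤1 = subst (1ℚ ℚ.- t ℚ.≤_) (ℚ.+-identityʳ 1ℚ) (ℚ.+-monoʳ-≤ 1ℚ (ℚ.neg-antimono-≤ 0≤t))

  eq : ∀ x y → x ℚ.+ t ℚ.* (y ℚ.- x) ≡ y ℚ.+ (1ℚ ℚ.- t) ℚ.* (x ℚ.- y)
  eq x y = solve 3 (λ t x y → x :+ t :* (y :- x) := y :+ (con 1ℚ :- t) :* (x :- y)) refl t x y

mix-negative : ∀ {x y t} → x ℚ.≤ 0ℚ → y ℚ.< 0ℚ → 0ℚ ℚ.< t → t ℚ.≤ 1ℚ →
               (1ℚ ℚ.- t) ℚ.* x ℚ.+ t ℚ.* y ℚ.< 0ℚ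
mix-negative {x} {y} {t} x≤0 y<0 0<t t≤1 =
  subst ((1ℚ ℚ.- t) ℚ.* x ℚ.+ t ℚ.* y ℚ.<_) (cong₂ ℚ._+_ (ℚ.*-zeroʳ (1ℚ ℚ.- t)) (ℚ.*-zeroʳ t))
    (ℚ.+-mono-≤-<
      (ℚ.*-monoˡ-≤-nonNeg (1ℚ ℚ.- t) {{ℚ.nonNegative (p≤q⇒0≤q-p t≤1)}} x≤0)
      (ℚ.*-monoʳ-<-pos t {{ℚ.positive 0<t}} y<0))

mix-nonNegative : ∀ {x y t} → 0ℚ ℚ.≤ x → 0ℚ ℚ.≤ y → 0ℚ ℚ.≤ t → t ℚ.≤ 1ℚ →
                  0ℚ ℚ.≤ (1ℚ ℚ.- t) ℚ.* x ℚ.+ t ℚ.* y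
mix-nonNegative {x} {y} {t} 0≤x 0≤y 0≤t t≤1 =
  subst (ℚ._≤ (1ℚ ℚ.- t) ℚ.* x ℚ.+ t ℚ.* y) (cong₂ ℚ._+_ (ℚ.*-zeroʳ (1ℚ ℚ.- t)) (ℚ.*-zeroʳ t))
    (ℚ.+-mono-≤
      (ℚ.*-monoˡ-≤-nonNeg (1ℚ ℚ.- t) {{ℚ.nonNegative (p≤q⇒0≤q-p t≤1)}} 0≤x)
      (ℚ.*-monoˡ-≤-nonNeg t {{ℚ.nonNegative 0≤t}} 0≤y))

-- The line rs weakly separates the segments ab and cd, and contains no point of
-- ab except possibly a.
Separates : Point → Point → Point → Point → Point → Point → Set
Separates r s a b c d =
  side r s a ℚ.≤ 0ℚ × side r s b ℚ.< 0ℚ × 0ℚ ℚ.≤ side r s c × 0ℚ ℚ.≤ side r s d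

separates? : ∀ r s a b c d → Dec (Separates r s a b c d)
separates? r s a b c d =
  side r s a ℚ.≤? 0ℚ ×-dec side r s b ℚ.<? 0ℚ ×-dec 0ℚ ℚ.≤? side r s c ×-dec 0ℚ ℚ.≤? side r s d

-- On `cd` the function `side r s` is nonnegative, while on `ab` it is negative at every parameter
-- `t` above 0. So a common point has `t` equal to 0, which is `a`.
separated-meet : ∀ r s a b c d {z} → Separates r s a b c d → z ∈[ a , b ] → z ∈[ c , d ] → z ≡ a
separated-meet r s a b c d {z} (a≤0 , b<0 , 0≤c , 0≤d)
  (t , 0≤t , t≤1 , z₁≡ , z₂≡) (u , 0≤u , u≤1 , z₁≡′ , z₂≡′) =
  trans z≡ (trans (cong (along a b) (ℚ.≤-antisym (ℚ.≮⇒≥ t≯0) 0≤t)) (along-0 a b))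
  where
  z≡ : z ≡ along a b t
  z≡ = cong₂ _,_ z₁≡ z₂≡

  side≡ : ∀ a b t → z ≡ along a b t → side r s z ≡ (1ℚ ℚ.- t) ℚ.* side r s a ℚ.+ t ℚ.* side r s b
  side≡ a b t z≡ = trans (cong (side r s) z≡) (side-along r s a b t)

  0≤side : 0ℚ ℚ.≤ side r s z
  0≤side = subst (0ℚ ℚ.≤_) (sym (side≡ c d u (cong₂ _,_ z₁≡′ z₂≡′))) (mix-nonNegative 0≤c 0≤d 0≤u u≤1)

  t≯0 : ¬ 0ℚ ℚ.< t
  t≯0 0<t = ℚ.<-irrefl {x = 0ℚ} refl (ℚ.≤-<-trans 0≤side
    (subst (ℚ._< 0ℚ) (sym (side≡ a b t z≡)) (mix-negative a≤0 b<0 0<t t≤1)))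

module _ {n} (pos : Fin n → Point) where

  -- It suffices to try the lines through two of the given points: tilting a
  -- separating line until it is blocked makes it one of these.
  SeparatedAt : Fin n → Fin n → Fin n → Fin n → Set
  SeparatedAt u v x y =
    ∃[ r ] ∃[ s ] Separates (pos r) (pos s) (pos u) (pos v) (pos x) (pos y)

  separatedAt? : ∀ u v x y → Dec (SeparatedAt u v x y)
  separatedAt? u v x y = Fin.any? λ r → Fin.any? λ s →
    separates? (pos r) (pos s) (pos u) (pos v) (pos x) (pos y)

  -- Distinct edges may share one end, and the separating line then passes through it. The two
  -- alternatives let either end of the first edge be that point.
  Separated : Fin n → Fin n → Fin n → Fin n → Set
  Separated u v x y = SeparatedAt u v x y ⊎ SeparatedAt v u x y

  separated? : ∀ u v x y → Dec (Separated u v x y)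
  separated? u v x y = separatedAt? u v x y ⊎-dec separatedAt? v u x y

  separated-∈ : ∀ {u v x y z} → Separated u v x y → z ∈[ pos u , pos v ] → z ∈[ pos x , pos y ] →
                z ≡ pos u ⊎ z ≡ pos v
  separated-∈ {u} {v} {x} {y} (inj₁ (r , s , sep)) z∈uv z∈xy =
    inj₁ (separated-meet (pos r) (pos s) (pos u) (pos v) (pos x) (pos y) sep z∈uv z∈xy)
  separated-∈ {u} {v} {x} {y} (inj₂ (r , s , sep)) z∈uv z∈xy =
    inj₂ (separated-meet (pos r) (pos s) (pos v) (pos u) (pos x) (pos y) sep
      (∈-reverse {pos u} {pos v} z∈uv) z∈xy)

module _ {n} (G : Graph n) {pos : Fin n → Point} (pos-injective : Injective _≡_ _≡_ pos) where
  open Graph G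

  -- A vertex is handled as the degenerate segment from `w` to `w`, so one separation test serves
  -- both conditions. For concrete positions both can be decided by evaluation.
  straightLineDrawing :
    (∀ u v → u ~ v → ∀ w → w ≡ u ⊎ w ≡ v ⊎ Separated pos u v w w) →
    (∀ u v → u ~ v → ∀ x y → x ~ y → (u , v) ≈ᴱ (x , y) ⊎ Separated pos u v x y) →
    PlaneDrawing G
  straightLineDrawing vertices edges = record
    { pos           = pos
    ; pos-injective = pos-injective
    ; arc           = λ u~v → segment (λ eq → ~-irrefl (pos-injective eq) u~v)
    ; arc-sym       = λ {u} {v} _ _ → ∈-reverse {pos u} {pos v}
    ; arc-vertex    = arc-vertex
    ; arc-arc       = arc-arc
    }
    where
    arc-vertex : ∀ {u v} → u ~ v → ∀ w → pos w ∈[ pos u , pos v ] → w ≡ u ⊎ w ≡ v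
    arc-vertex {u} {v} u~v w w∈uv =
      [ inj₁ , [ inj₂ , (λ sep → Sum.map pos-injective pos-injective
        (separated-∈ pos sep w∈uv (∈-startpoint (pos w) (pos w)))) ]′ ]′ (vertices u v u~v w)

    arc-arc : ∀ {u v x y} → u ~ v → x ~ y → ¬ (u , v) ≈ᴱ (x , y) →
              ∀ {z} → z ∈[ pos u , pos v ] → z ∈[ pos x , pos y ] → z ≡ pos u ⊎ z ≡ pos v
    arc-arc {u} {v} {x} {y} u~v x~y uv≉xy z∈uv z∈xy =
      [ (λ uv≈xy → contradiction uv≈xy uv≉xy) , (λ sep → separated-∈ pos sep z∈uv z∈xy) ]′
        (edges u v u~v x y x~y)

-- Connectivity, triangles and signatures

IsMaximum-unique : ∀ {P j k} → IsMaximum P j → IsMaximum P k → j ≡ k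
IsMaximum-unique (pj , j-max) (pk , k-max) = ℕ.≤-antisym (k-max pj) (j-max pk)

IsMinimum-unique : ∀ {P j k} → IsMinimum P j → IsMinimum P k → j ≡ k
IsMinimum-unique (pj , j-min) (pk , k-min) = ℕ.≤-antisym (j-min pk) (k-min pj)

∣X∣<2⇒x≡y : ∀ {n} {X : Subset n} {x y} → ∣ X ∣ < 2 → x Subset.∈ X → y Subset.∈ X → x ≡ y
∣X∣<2⇒x≡y {X = X} {x} {y} ∣X∣<2 x∈X y∈X with x Fin.≟ y
... | yes x≡y = x≡y
... | no  x≢y = contradiction ∣X∣<2 (ℕ.≤⇒≯ (ℕ.≤-trans (s≤s 1≤) (x∈p⇒∣p-x∣<∣p∣ x∈X)))
  where
  1≤ : 1 ≤ ∣ X Subset.- x ∣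
  1≤ = ℕ.≤-trans (s≤s z≤n) (x∈p⇒∣p-x∣<∣p∣ (x∈p∧x≢y⇒x∈p-y y∈X (x≢y ∘ sym)))

module _ {n} (G : Graph n) where
  open Graph G

  CommonNeighbour : Fin n → Fin n → Fin n → Set
  CommonNeighbour u v w = u ~ w × w ~ v

  commonNeighbour? : ∀ u v w → Dec (CommonNeighbour u v w)
  commonNeighbour? u v w = (u ~? w) ×-dec (w ~? v)

  -- A set of at most one vertex cannot contain both common neighbours, so a path of length at most
  -- two survives its removal.
  twoCommonNeighbours⇒2-connected : 2 < n →
    (∀ u v → u ≡ v ⊎ u ~ v ⊎
      ∃[ w ] ∃[ x ] (w ≢ x × CommonNeighbour u v w × CommonNeighbour u v x)) →
    VertexConnected 2 G
  twoCommonNeighbours⇒2-connected 2<n links = 2<n , connected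
    where
    connected : ∀ (X : Subset n) → ∣ X ∣ < 2 → ∀ {u v} → u Subset.∉ X → v Subset.∉ X →
                Star (λ x y → x ~ y × x Subset.∉ X × y Subset.∉ X) u v
    connected X ∣X∣<2 {u} {v} u∉X v∉X with links u v
    ... | inj₁ refl       = ε
    ... | inj₂ (inj₁ u~v) = (u~v , u∉X , v∉X) ◅ ε
    ... | inj₂ (inj₂ (w , x , w≢x , (u~w , w~v) , (u~x , x~v))) with w ∈? X | x ∈? X
    ...   | no w∉X  | _       = (u~w , u∉X , w∉X) ◅ (w~v , w∉X , v∉X) ◅ ε
    ...   | yes _   | no x∉X  = (u~x , u∉X , x∉X) ◅ (x~v , x∉X , v∉X) ◅ ε
    ...   | yes w∈X | yes x∈X = contradiction (∣X∣<2⇒x≡y ∣X∣<2 w∈X x∈X) w≢x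

  triangle : ∀ {a b c} → a ~ b → b ~ c → c ~ a → Cycle G
  triangle a~b b~c c~a = record
    { walk     = a~b ◅ b~c ◅ c~a ◅ ε
    ; distinct = ((λ { refl → ~-irrefl refl a~b }) ∷ (λ { refl → ~-irrefl refl c~a }) ∷ []) ∷
                 ((λ { refl → ~-irrefl refl b~c }) ∷ []) ∷ [] ∷ []
    ; long     = s≤s (s≤s (s≤s z≤n))
    }

  edgeDisjoint? : (c d : Cycle G) → Dec (EdgeDisjoint c d)
  edgeDisjoint? c d = all? (λ e → all? (λ f → ¬? (e ≈ᴱ? f)) (cycleEdges d)) (cycleEdges c)

infix 4 _∈ᴱ_ _∈ᴱ?_
_∈ᴱ_ : ∀ {n} → Fin n × Fin n → List (Fin n × Fin n) → Set
e ∈ᴱ F = Any (e ≈ᴱ_) F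

_∈ᴱ?_ : ∀ {n} (e : Fin n × Fin n) F → Dec (e ∈ᴱ F)
e ∈ᴱ? F = any? (e ≈ᴱ?_) F

Meets : ∀ {n} → List (Fin n × Fin n) → List (Fin n × Fin n) → Set
Meets F es = Any (_∈ᴱ F) es

meets? : ∀ {n} (F es : List (Fin n × Fin n)) → Dec (Meets F es)
meets? F es = any? (_∈ᴱ? F) es

-- The lists `es` and `fs` lie in the cycles only up to orientation, because a cycle may be
-- traversed from another base or backwards. The common edge is therefore carried from one cycle to
-- the other along `_≈ᴱ_`.
shared-edge⇒¬EdgeDisjoint : ∀ {n} {G : Graph n} {c d : Cycle G} {es fs} →
  All (_∈ᴱ cycleEdges c) es → All (_∈ᴱ cycleEdges d) fs → Meets fs es → ¬ EdgeDisjoint c d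
shared-edge⇒¬EdgeDisjoint es⊆c fs⊆d meet c#d =
  let e∈c  , e∈fs = All.lookupAny es⊆c meet
      f∈d  , e≈f  = All.lookupAny fs⊆d e∈fs
      g#d  , e≈g  = All.lookupAny c#d e∈c
      g≉h  , f≈h  = All.lookupAny g#d f∈d
  in  g≉h (≈ᴱ-trans (≈ᴱ-sym e≈g) (≈ᴱ-trans e≈f f≈h))

module _ {n} (S : SignedGraph n) {F : List (Fin n × Fin n)} where
  open SignedGraph S using (_~_; sign)

  private
    G  = graph S
    G′ = graph (S ∖ F)

  avoid : ∀ {u v} (w : Star _~_ u v) → All (λ e → ¬ e ∈ᴱ F) (walkEdges G w) → Star (Graph._~_ G′) u v
  avoid ε       []         = ε
  avoid (e ◅ w) (e∉F ∷ ∉F) = (e , e∉F) ◅ avoid w ∉F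

  starts-avoid : ∀ {u v} (w : Star _~_ u v) ∉F → starts G′ (avoid w ∉F) ≡ starts G w
  starts-avoid ε       []       = refl
  starts-avoid (_ ◅ w) (_ ∷ ∉F) = cong (_ ∷_) (starts-avoid w ∉F)

  walkSign-avoid : ∀ {u v} (w : Star _~_ u v) ∉F → walkSign (S ∖ F) (avoid w ∉F) ≡ walkSign S w
  walkSign-avoid ε       []       = refl
  walkSign-avoid (e ◅ w) (_ ∷ ∉F) = cong (sign e Sign.*_) (walkSign-avoid w ∉F)

  -- A negative cycle avoiding `F` would survive the deletion with its sign unchanged. As `Meets` is
  -- decidable, this contradiction yields an actual common edge.
  balanced⇒meets-negative : Balanced (S ∖ F) → ∀ c → IsNegative S c → Meets F (cycleEdges c)
  balanced⇒meets-negative balanced c negative =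
    decidable-stable (meets? F (cycleEdges c)) λ ¬meets →
      let w   = Cycle.walk c
          ∉F  = ¬Any⇒All¬ (cycleEdges c) ¬meets
          eq  = sym (starts-avoid w ∉F)
          c′  = record
            { walk     = avoid w ∉F
            ; distinct = subst Unique eq (Cycle.distinct c)
            ; long     = subst (λ vs → 3 ≤ length vs) eq (Cycle.long c)
            }
          +≡- = trans (sym (balanced c′)) (trans (walkSign-avoid w ∉F) negative)
      in  contradiction +≡- λ ()

module _ {n} (N : List (Fin n × Fin n)) where

  edgeSign : Fin n × Fin n → Sign
  edgeSign e = if does (e ∈ᴱ? N) then Sign.- else Sign.+

module _ {n} (G : Graph n) (N : List (Fin n × Fin n)) where

  withNegativeEdges : SignedGraph n
  withNegativeEdges = record
    { graph    = G
    ; sign     = λ {u} {v} _ → edgeSign N (u , v)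
    ; sign-sym = λ {u} {v} _ _ → cong (if_then Sign.- else Sign.+)
        (does-⇔ (mk⇔ (Any.map ≈ᴱ-swapˡ) (Any.map ≈ᴱ-swapˡ)) ((u , v) ∈ᴱ? N) ((v , u) ∈ᴱ? N))
    }

  -- All remaining edges are positive, hence so is every walk. The induction is on open walks, since
  -- the tail of a closed walk is not closed.
  deleteNegativeEdges-balanced : Balanced (withNegativeEdges ∖ N)
  deleteNegativeEdges-balanced c = positive (Cycle.walk c)
    where
    positive : ∀ {u v} (w : Star (Graph._~_ (deleteEdges G N)) u v) →
               walkSign (withNegativeEdges ∖ N) w ≡ Sign.+
    positive ε                         = refl
    positive (_◅_ {u} {v} (_ , ∉N) w) = cong₂ Sign._*_
      (cong (if_then Sign.- else Sign.+) (dec-false ((u , v) ∈ᴱ? N) ∉N)) (positive w)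

-- The example

W₅⁺ : Graph 6
W₅⁺ = addEdge W₅ 1F 3F λ ()

open Graph W₅⁺ using (_~_; _~?_)

-- Vertices 1, 3, 4, 5 are the corners of a rectangle whose top side is the chord 13. Vertex 2 is
-- pulled inside, between that chord and the hub.
position : Fin 6 → Point
position 0F = 1ℚ , 1ℚ
position 1F = 0ℚ , (+ 3) / 1
position 2F = 1ℚ , (+ 2) / 1
position 3F = (+ 2) / 1 , (+ 3) / 1
position 4F = (+ 2) / 1 , 0ℚ
position 5F = 0ℚ , 0ℚ

position-injective : ∀ u v → position u ≡ position v → u ≡ v
position-injective = from-yes (Fin.all? λ u → Fin.all? λ v →
  ≡-dec ℚ._≟_ ℚ._≟_ (position u) (position v) →-dec u Fin.≟ v)

planar : Planar W₅⁺
planar = straightLineDrawing W₅⁺ (position-injective _ _)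
  (from-yes (Fin.all? λ u → Fin.all? λ v → (u ~? v) →-dec
    Fin.all? λ w → (w Fin.≟ u) ⊎-dec (w Fin.≟ v) ⊎-dec separated? position u v w w))
  (from-yes (Fin.all? λ u → Fin.all? λ v → (u ~? v) →-dec
    Fin.all? λ x → Fin.all? λ y → (x ~? y) →-dec
      (((u , v) ≈ᴱ? (x , y)) ⊎-dec separated? position u v x y)))

-- Signature and frustration index of the example

negativeEdges : List (Fin 6 × Fin 6)
negativeEdges = (0F , 2F) ∷ (1F , 3F) ∷ (4F , 5F) ∷ []

W₅± : SignedGraph 6
W₅± = withNegativeEdges W₅⁺ negativeEdges

triangle⁺ : ∀ a b c {_ : True (a ~? b)} {_ : True (b ~? c)} {_ : True (c ~? a)} → Cycle W₅⁺
triangle⁺ a b c {p} {q} {r} = triangle W₅⁺ (toWitness p) (toWitness q) (toWitness r)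

-- These are all the negative triangles of the example. `negative-triangle` checks the completeness,
-- on which the packing bound relies.
negativeTriangles : List (Cycle W₅⁺)
negativeTriangles = triangle⁺ 0F 1F 2F ∷ triangle⁺ 0F 1F 3F ∷ triangle⁺ 0F 2F 3F ∷ triangle⁺ 1F 2F 3F ∷
                    triangle⁺ 0F 4F 5F ∷ []

negativeTriangles-negative : All (IsNegative W₅±) negativeTriangles
negativeTriangles-negative = refl ∷ refl ∷ refl ∷ refl ∷ refl ∷ []

negativeTriangleEdges : List (List (Fin 6 × Fin 6))
negativeTriangleEdges = map cycleEdges negativeTriangles

-- Checked over all quadruples of vertices. A pair that is not an edge meets no triangle, so it
-- cannot help to cover.
two-edges-miss : ∀ a b c d → ¬ All (Meets ((a , b) ∷ (c , d) ∷ [])) negativeTriangleEdges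
two-edges-miss = from-yes (Fin.all? λ a → Fin.all? λ b → Fin.all? λ c → Fin.all? λ d →
  ¬? (all? (meets? ((a , b) ∷ (c , d) ∷ [])) negativeTriangleEdges))

covering⇒3≤length : ∀ F → All (Meets F) negativeTriangleEdges → 3 ≤ length F
covering⇒3≤length []                    (meet ∷ _) = contradiction (proj₂ (Any.satisfied meet)) λ ()
-- A single edge is repeated to fall under the case of two edges.
covering⇒3≤length ((a , b) ∷ [])        meets      =
  contradiction (All.map (Any.map λ { (here e≈) → here e≈ }) meets) (two-edges-miss a b a b)
covering⇒3≤length ((a , b) ∷ (c , d) ∷ []) meets   = contradiction meets (two-edges-miss a b c d)
covering⇒3≤length (_ ∷ _ ∷ _ ∷ _)       _          = s≤s (s≤s (s≤s z≤n))

-- Deleting the three negative edges gives the upper bound. For the lower bound, a balancing set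
-- must meet each of the listed negative triangles.
frustrationIndex : FrustrationIndex W₅± 3
frustrationIndex = (_ , (edges , distinct , deleteNegativeEdges-balanced W₅⁺ _) , refl) , minimal
  where
  edges : All (λ e → proj₁ e ~ proj₂ e) negativeEdges
  edges = from-yes (all? (λ e → proj₁ e ~? proj₂ e) negativeEdges)

  distinct : AllPairs (λ e f → ¬ e ≈ᴱ f) negativeEdges
  distinct = from-yes (allPairs? (λ e f → ¬? (e ≈ᴱ? f)) negativeEdges)

  minimal : ∀ {k} → ∃[ F ] (IsBalancingSet W₅± F × length F ≡ k) → 3 ≤ k
  minimal (F , (_ , _ , balanced) , refl) = covering⇒3≤length F
    (All.map⁺ (All.map (λ {c} → balanced⇒meets-negative W₅± balanced c) negativeTriangles-negative))

-- Cycle packings in the example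

W₅⁺-packing-length≤9 : ∀ {cs : List (Cycle W₅⁺)} → AllPairs EdgeDisjoint cs →
                       length (concatMap cycleEdges cs) ≤ 9
-- The degrees are 5, 4, 3, 4, 3, 3, so the sum of their halves, rounded down, evaluates to 9.
W₅⁺-packing-length≤9 = packing-length≤ W₅⁺

W₅⁺-packing≤3 : ∀ {cs : List (Cycle W₅⁺)} → AllPairs EdgeDisjoint cs → length cs ≤ 3
W₅⁺-packing≤3 {cs} cs! =
  ℕ.*-cancelʳ-≤ (length cs) 3 3 (ℕ.≤-trans (3*length≤packing-length W₅⁺ cs) (W₅⁺-packing-length≤9 cs!))

-- At most three edges, together with `long`, leave exactly three. What remains is a finite check
-- over vertex triples, in every rotation and direction.
negative-triangle : ∀ c → length (cycleEdges c) ≤ 3 → IsNegative W₅± c →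
                    Any (All (_∈ᴱ cycleEdges c)) negativeTriangleEdges
negative-triangle record { walk = ε ; long = () }
negative-triangle record { walk = _ ◅ ε ; long = s≤s () }
negative-triangle record { walk = _ ◅ _ ◅ ε ; long = s≤s (s≤s ()) }
negative-triangle record { walk = _ ◅ _ ◅ _ ◅ _ ◅ _ } (s≤s (s≤s (s≤s ())))
negative-triangle record { walk = p ◅ q ◅ r ◅ ε } _ = closed _ _ _ p q r
  where
  σ : Fin 6 → Fin 6 → Sign
  σ u v = edgeSign negativeEdges (u , v)

  -- The trailing factor `Sign.+` is the value of `walkSign` at `ε`; keeping it makes the premise
  -- match `IsNegative` definitionally.
  closed : ∀ a b c → a ~ b → b ~ c → c ~ a → σ a b Sign.* (σ b c Sign.* (σ c a Sign.* Sign.+)) ≡ Sign.- →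
           Any (All (_∈ᴱ ((a , b) ∷ (b , c) ∷ (c , a) ∷ []))) negativeTriangleEdges
  closed = from-yes (Fin.all? λ a → Fin.all? λ b → Fin.all? λ c →
    (a ~? b) →-dec (b ~? c) →-dec (c ~? a) →-dec
    (σ a b Sign.* (σ b c Sign.* (σ c a Sign.* Sign.+)) Sign.≟ Sign.-) →-dec
    any? (all? (_∈ᴱ? ((a , b) ∷ (b , c) ∷ (c , a) ∷ []))) negativeTriangleEdges)

-- Two triangles on the vertices 0, 1, 2, 3 always share an edge, and 045 is the only other entry.
-- Triples with repetitions are included, as a triangle meets itself.
three-negative-triangles-meet :
  All (λ es → All (λ fs → All (λ gs → Meets fs es ⊎ Meets gs es ⊎ Meets gs fs)
    negativeTriangleEdges) negativeTriangleEdges) negativeTriangleEdges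
three-negative-triangles-meet =
  from-yes (all? (λ es → all? (λ fs → all? (λ gs → meets? fs es ⊎-dec meets? gs es ⊎-dec meets? gs fs)
    negativeTriangleEdges) negativeTriangleEdges) negativeTriangleEdges)

-- Every cycle has at least three edges, so a total of at most three per cycle leaves no slack.
-- Subtracting the lower bound for the tail bounds the head, and conversely.
triangles-of-minimum-length : ∀ {n} (G : Graph n) (cs : List (Cycle G)) →
  length (concatMap cycleEdges cs) ≤ length cs * 3 → All (λ c → length (cycleEdges c) ≤ 3) cs
triangles-of-minimum-length G []       _     = []
triangles-of-minimum-length G (c ∷ cs) total≤ =
  ℕ.+-cancelʳ-≤ k l 3 (ℕ.≤-trans (ℕ.+-monoʳ-≤ l (3*length≤packing-length G cs)) total≤′) ∷
  triangles-of-minimum-length G cs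
    (ℕ.+-cancelˡ-≤ 3 m k (ℕ.≤-trans (ℕ.+-monoˡ-≤ m (cycle-length≥3 G c)) total≤′))
  where
  k = length cs * 3
  l = length (cycleEdges c)
  m = length (concatMap cycleEdges cs)

  total≤′ : l + m ≤ 3 + k
  total≤′ = subst (_≤ 3 + k) (length-++ (cycleEdges c)) total≤

no-three-disjoint-negative-cycles : ∀ {c d e : Cycle W₅⁺} → All (IsNegative W₅±) (c ∷ d ∷ e ∷ []) →
                                    ¬ AllPairs EdgeDisjoint (c ∷ d ∷ e ∷ [])
no-three-disjoint-negative-cycles {c} {d} {e} (c- ∷ d- ∷ e- ∷ [])
  disjoint@((c#d ∷ c#e ∷ []) ∷ (d#e ∷ []) ∷ [] ∷ [])
  with triangles-of-minimum-length W₅⁺ (c ∷ d ∷ e ∷ []) (W₅⁺-packing-length≤9 disjoint)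
... | c≤3 ∷ d≤3 ∷ e≤3 ∷ [] =
  let meet₁ , ⊆c = All.lookupAny three-negative-triangles-meet (negative-triangle c c≤3 c-)
      meet₂ , ⊆d = All.lookupAny meet₁ (negative-triangle d d≤3 d-)
      meet₃ , ⊆e = All.lookupAny meet₂ (negative-triangle e e≤3 e-)
  in  [ (λ meet → shared-edge⇒¬EdgeDisjoint {c = c} {d} ⊆c ⊆d meet c#d)
      , [ (λ meet → shared-edge⇒¬EdgeDisjoint {c = c} {e} ⊆c ⊆e meet c#e)
        , (λ meet → shared-edge⇒¬EdgeDisjoint {c = d} {e} ⊆d ⊆e meet d#e) ]′ ]′ meet₃

negativeCyclePackingNumber : NegativeCyclePackingNumber W₅± 2
negativeCyclePackingNumber = (cs , refl ∷ refl ∷ [] , disjoint , refl) , maximal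
  where
  cs = triangle⁺ 0F 1F 2F ∷ triangle⁺ 0F 4F 5F ∷ []

  disjoint : AllPairs EdgeDisjoint cs
  disjoint = from-yes (allPairs? (edgeDisjoint? W₅⁺) cs)

  maximal : ∀ {j} → HasPacking W₅⁺ (IsNegative W₅±) j → j ≤ 2
  maximal ([]         , _ , _ , refl) = z≤n
  maximal (_ ∷ []     , _ , _ , refl) = s≤s z≤n
  maximal (_ ∷ _ ∷ [] , _ , _ , refl) = s≤s (s≤s z≤n)
  -- In any larger packing the first three cycles already give the contradiction.
  maximal (c ∷ d ∷ e ∷ _ , c- ∷ d- ∷ e- ∷ _ , (c#d ∷ c#e ∷ _) ∷ (d#e ∷ _) ∷ _ , _) =
    contradiction ((c#d ∷ c#e ∷ []) ∷ (d#e ∷ []) ∷ [] ∷ [])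
      (no-three-disjoint-negative-cycles {c} {d} {e} (c- ∷ d- ∷ e- ∷ []))

-- These use every edge except 02 and 45, which is nine edges and so attains the bound. Only 123
-- among them is negative.
disjointTriangles : List (Cycle W₅⁺)
disjointTriangles = triangle⁺ 1F 2F 3F ∷ triangle⁺ 0F 3F 4F ∷ triangle⁺ 0F 1F 5F ∷ []

disjointTriangles-disjoint : AllPairs EdgeDisjoint disjointTriangles
disjointTriangles-disjoint = from-yes (allPairs? (edgeDisjoint? W₅⁺) disjointTriangles)

trianglePackingNumber : TrianglePackingNumber W₅⁺ 3
trianglePackingNumber =
  (disjointTriangles , refl ∷ refl ∷ refl ∷ [] , disjointTriangles-disjoint , refl) ,
  λ { (_ , _ , cs! , refl) → W₅⁺-packing≤3 cs! }

cyclePackingNumber : CyclePackingNumber W₅⁺ 3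
cyclePackingNumber =
  (disjointTriangles , tt ∷ tt ∷ tt ∷ [] , disjointTriangles-disjoint , refl) ,
  λ { (_ , _ , cs! , refl) → W₅⁺-packing≤3 cs! }

-- Connectivity, degrees and conclusion

2-connected : VertexConnected 2 W₅⁺
2-connected = twoCommonNeighbours⇒2-connected W₅⁺ (s≤s (s≤s (s≤s z≤n)))
  -- Non-adjacent vertices both lie on the rim; they share the hub and the rim vertex between them.
  (from-yes (Fin.all? λ u → Fin.all? λ v → (u Fin.≟ v) ⊎-dec (u ~? v) ⊎-dec
    Fin.any? λ w → Fin.any? λ x →
      ¬? (w Fin.≟ x) ×-dec commonNeighbour? W₅⁺ u v w ×-dec commonNeighbour? W₅⁺ u v x))

minDegree : MinDegree W₅⁺ 3
minDegree = from-yes (Fin.all? λ v → 3 ℕ.≤? degree W₅⁺ v) , 2F , refl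

isEdgeAddition : IsEdgeAddition W₅⁺ W₅
isEdgeAddition =
  1F , 3F , (λ ()) , from-yes (¬? (Graph._~?_ W₅ 1F 3F)) , ↔-id (Fin 6) , λ x y → mk⇔ id id

¬packingEquality : ¬ PackingEquality W₅±
¬packingEquality equality
  with equality negativeCyclePackingNumber frustrationIndex cyclePackingNumber
... | ()

mainTheorem13 : (∃[ n ] Σ[ S ∈ SignedGraph n ]
    ( Planar (graph S)
    × VertexConnected 2 (graph S)
    × MinDegree (graph S) 3
    × IsEdgeAddition (graph S) W₅
    × FrustrationIndex S 3
    × NegativeCyclePackingNumber S 2
    × TrianglePackingNumber (graph S) 3
    × CyclePackingNumber (graph S) 3
    × (∀ {p⁻ l p△} → NegativeCyclePackingNumber S p⁻ → FrustrationIndex S l →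
    TrianglePackingNumber (graph S) p△ → p⁻ < l ⊓ p△)))
    × ¬ (∀ {n} (S : SignedGraph n) → PackingEquality S)
    × ¬ (∀ {n} (S : SignedGraph n) → Planar (graph S) → PackingEquality S)
mainTheorem13 =
  (6 , W₅± , planar , 2-connected , minDegree , isEdgeAddition , frustrationIndex ,
   negativeCyclePackingNumber , trianglePackingNumber , cyclePackingNumber , strict) ,
  (λ equality → ¬packingEquality (equality W₅±)) ,
  (λ equality → ¬packingEquality (equality W₅± planar))
  where
  strict : ∀ {p⁻ l p△} → NegativeCyclePackingNumber W₅± p⁻ → FrustrationIndex W₅± l →
           TrianglePackingNumber W₅⁺ p△ → p⁻ < l ⊓ p△
  strict p⁻ l p△
    -- Uniqueness pins the three values to 2, 3 and 3, which turns the goal into `3 ≤ 3`.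
    rewrite IsMaximum-unique p⁻ negativeCyclePackingNumber
          | IsMinimum-unique l frustrationIndex
          | IsMaximum-unique p△ trianglePackingNumber = ℕ.≤-refl
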